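{- For positive integers $a$, $b$ and $n$ with $n<2b$ and $a+3b\le 2n$, we have $\alpha(\Gamma(n,\{a,b\}))=\binom{n-1}{b}\binom{b}{a}$.
   Context: $[n]=\{1,\dots,n\}$. Subsets $X,Y$ of $[n]$ are in general position if $X\cup Y=[n]$ or $X\cap Y=\emptyset$. For $a<b$, the vertices of $\Gamma(n,\{a,b\})$ are the pairs $(A,B)$ with $A\subseteq B\subseteq[n]$, $|A|=a$, $|B|=b$ (flags of type $\{a,b\}$), and $(A,B)$, $(A',B')$ are adjacent iff each of $A,B$ is in general position with each of $A',B'$. $\alpha$ denotes the independence number. -}

module Defs where

open import Data.Nat using (ℕ)
open import Data.Fin.Subset using (Subset; _⊆_; ∣_∣; ⊤; ⊥; _∪_; _∩_)
open import Data.Product using (_×_; _,_; Σ)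
open import Data.Sum using (_⊎_)
open import Data.List using (List; length)
open import Data.List.Relation.Unary.All using (All)
open import Data.List.Relation.Unary.AllPairs using (AllPairs)
open import Data.List.Relation.Unary.Unique.Propositional using (Unique)
open import Relation.Binary.PropositionalEquality using (_≡_)
open import Relation.Nullary using (¬_)

GenPos : ∀ {n} → Subset n → Subset n → Set
GenPos X Y = (X ∪ Y ≡ ⊤) ⊎ (X ∩ Y ≡ ⊥)

Pair : ℕ → Set
Pair n = Subset n × Subset n

IsFlag : ∀ {n} → ℕ → ℕ → Pair n → Set
IsFlag a b (A , B) = (A ⊆ B) × (∣ A ∣ ≡ a) × (∣ B ∣ ≡ b)

Adj : ∀ {n} → Pair n → Pair n → Set
Adj (A , B) (A' , B') =
  GenPos A A' × GenPos A B' × GenPos B A' × GenPos B B'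

IsIndependent : ∀ {n} → ℕ → ℕ → List (Pair n) → Set
IsIndependent a b S =
  All (IsFlag a b) S × Unique S × AllPairs (λ u v → ¬ Adj u v) S

IndependenceNumberIs : (n a b k : ℕ) → Set
IndependenceNumberIs n a b k =
  Σ (List (Pair n)) (λ S → IsIndependent a b S × length S ≡ k)
  × (∀ (S : List (Pair n)) → IsIndependent a b S → length S Data.Nat.≤ k)

{-# OPTIONS --safe #-}
-- As n < 2b and a + b < n, two flags (A , B), (A′ , B′) are adjacent exactly when
-- the complements C, C′ of B, B′ are disjoint, A ⊆ C′ and A′ ⊆ C.  Hence the
-- flags with a fixed point outside B are independent.  For the upper bound use
-- Katona's cycle method: in a cyclic order of [n] let C be an arc of length
-- c = n ∸ b and put A in the middle of the opposite arc.  As a + 3b ≤ 2n, two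
-- of the n rotations of this flag are adjacent as soon as their arcs C are
-- disjoint, so at most c of them are independent.  Averaging over all
-- arrangements of [n] bounds the density of an independent set by c / n.

module Submission where

open import Defs
open import Data.Nat using (ℕ; zero; suc; _≤_; _<_; _+_; _*_; _∸_; _!; z≤n; s≤s; _≤?_; _<?_; ⌊_/2⌋; ⌈_/2⌉; NonZero)
open import Data.Nat.Combinatorics using (_C_; nCk≡n!/k![n-k]!; k![n∸k]!∣n!; nCk+nC[k+1]≡[n+1]C[k+1])
open import Data.Nat.Properties
open import Data.Nat.Tactic.RingSolver using (solve-∀)
open import Data.Fin using (Fin; zero; suc; toℕ)
open import Data.Fin.Properties using (any?; toℕ<n; toℕ≤pred[n])
open import Data.Nat.DivMod using (_/_; _%_; m%n<n; m<n⇒m%n≡m; [m+n]%n≡m%n; [m+kn]%n≡m%n; m≡m%n+[m/n]*n; m/n*n≡m)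
open import Data.Bool using (Bool; true; false; _∧_; _∨_)
open import Data.Fin.Subset using (Subset; _⊆_; ∣_∣; ⊤; ⊥; _∪_; _∩_)
open import Data.Fin.Subset.Properties using (drop-∷-⊆; out⊆; s⊆s; ∪-idem; ∣⊤∣≡n)
open import Data.List as List using (List; []; _∷_; _++_; length)
open import Data.List.Properties using (length-map; length-++)
open import Data.List.Membership.Propositional.Properties using (∈-map⁻; ∈-++⁻)
open import Data.List.Relation.Binary.Disjoint.Propositional using (Disjoint)
open import Data.List.Relation.Unary.All as All using (All; []; _∷_)
open import Data.List.Relation.Unary.All.Properties using (map⁺; ++⁺)
open import Data.List.Relation.Unary.AllPairs using (AllPairs; []; _∷_)
import Data.List.Relation.Unary.AllPairs.Properties as AllPairs
open import Data.List.Relation.Unary.Unique.Propositional using (Unique)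
import Data.List.Relation.Unary.Unique.Propositional.Properties as Unique
open import Data.Sum using (inj₁; inj₂; [_,_]′)
open import Data.Vec using (Vec; []; _∷_; here; lookup; insertAt; removeAt; tabulate; map; zipWith; replicate)
open import Data.Vec.Properties using (insertAt-removeAt; removeAt-insertAt; insertAt-lookup; ≡-dec; tabulate-cong; ∷-injectiveʳ)
open import Data.Vec.Relation.Binary.Pointwise.Inductive as Pointwise using (Pointwise; []; _∷_)
open import Data.Product using (∃; _×_; _,_; proj₁; proj₂)
open import Relation.Binary using (DecidableEquality)
open import Relation.Binary.PropositionalEquality
open import Relation.Nullary using (Dec; yes; no; ¬_; contradiction; _×-dec_)
open import Function using (_∘_; const)
open import Algebra.Properties.Semiring.Sum +-*-semiring

-- Indicators and finite sums.

δ : ∀ {p} {P : Set p} → Dec P → ℕ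
δ (yes _) = 1
δ (no _)  = 0

δ-yes : ∀ {p} {P : Set p} (P? : Dec P) → P → δ P? ≡ 1
δ-yes (yes _) p = refl
δ-yes (no ¬p) p = contradiction p ¬p

δ-no : ∀ {p} {P : Set p} (P? : Dec P) → ¬ P → δ P? ≡ 0
δ-no (yes p) ¬p = contradiction p ¬p
δ-no (no _)  ¬p = refl

δ-⇔ : ∀ {p q} {P : Set p} {Q : Set q} (P? : Dec P) (Q? : Dec Q) →
      (P → Q) → (Q → P) → δ P? ≡ δ Q?
δ-⇔ (yes p) Q? f g = sym (δ-yes Q? (f p))
δ-⇔ (no ¬p) Q? f g = sym (δ-no Q? (¬p ∘ g))

δ-× : ∀ {p q} {P : Set p} {Q : Set q} (P? : Dec P) (Q? : Dec Q) →
      δ (P? ×-dec Q?) ≡ δ P? * δ Q?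
δ-× (yes _) (yes _) = refl
δ-× (yes _) (no _)  = refl
δ-× (no _)  _       = refl

sum-mono : ∀ {n} (f g : Fin n → ℕ) → (∀ i → f i ≤ g i) → sum f ≤ sum g
sum-mono {zero}  f g f≤g = z≤n
sum-mono {suc n} f g f≤g = +-mono-≤ (f≤g zero) (sum-mono (f ∘ suc) (g ∘ suc) (f≤g ∘ suc))

sum-const : ∀ n k → sum {n} (const k) ≡ n * k
sum-const zero    k = refl
sum-const (suc n) k = cong (k +_) (sum-const n k)

-- Sums over all arrangements.

-- Permutations of n letters, recorded as the positions at which the letters
-- are successively inserted.

data Arrangement : ℕ → Set where
  []  : Arrangement 0
  _∷_ : ∀ {n} → Fin (suc n) → Arrangement n → Arrangement (suc n)

arrange : ∀ {A : Set} {n} → Arrangement n → Vec A n → Vec A n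
arrange []      []      = []
arrange (i ∷ σ) (x ∷ w) = insertAt (arrange σ w) i x

sumArr : ∀ {n} → (Arrangement n → ℕ) → ℕ
sumArr {zero}  f = f []
sumArr {suc n} f = ∑[ i < suc n ] sumArr (λ σ → f (i ∷ σ))

sumArr-cong : ∀ {n} {f g : Arrangement n → ℕ} → (∀ σ → f σ ≡ g σ) → sumArr f ≡ sumArr g
sumArr-cong {zero}  f≗g = f≗g []
sumArr-cong {suc n} f≗g = sum-cong-≗ λ i → sumArr-cong λ σ → f≗g (i ∷ σ)

sumArr-mono : ∀ {n} {f g : Arrangement n → ℕ} → (∀ σ → f σ ≤ g σ) → sumArr f ≤ sumArr g
sumArr-mono {zero}  f≤g = f≤g []
sumArr-mono {suc n} f≤g = sum-mono _ _ λ i → sumArr-mono λ σ → f≤g (i ∷ σ)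

sumArr-const : ∀ n k → sumArr {n} (const k) ≡ n ! * k
sumArr-const zero    k = sym (+-identityʳ k)
sumArr-const (suc n) k = begin
  sum {suc n} (λ _ → sumArr {n} (const k)) ≡⟨ sum-cong-≗ {suc n} (λ _ → sumArr-const n k) ⟩
  sum {suc n} (λ _ → n ! * k)              ≡⟨ sum-const (suc n) (n ! * k) ⟩
  suc n * (n ! * k)                        ≡⟨ *-assoc (suc n) (n !) k ⟨
  suc n ! * k                              ∎
  where open ≡-Reasoning

sumArr-*ˡ : ∀ {n} k (f : Arrangement n → ℕ) → sumArr (λ σ → k * f σ) ≡ k * sumArr f
sumArr-*ˡ {zero}  k f = refl
sumArr-*ˡ {suc n} k f = trans (sum-cong-≗ λ i → sumArr-*ˡ k (λ σ → f (i ∷ σ)))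
                              (sym (*-distribˡ-sum k λ i → sumArr (λ σ → f (i ∷ σ))))

sumArr-+ : ∀ {n} (f g : Arrangement n → ℕ) → sumArr (λ σ → f σ + g σ) ≡ sumArr f + sumArr g
sumArr-+ {zero}  f g = refl
sumArr-+ {suc n} f g = trans (sum-cong-≗ λ i → sumArr-+ (λ σ → f (i ∷ σ)) (λ σ → g (i ∷ σ)))
                             (∑-distrib-+ (λ i → sumArr (λ σ → f (i ∷ σ))) (λ i → sumArr (λ σ → g (i ∷ σ))))

sumArr-∑ : ∀ {n} m (f : Fin m → Arrangement n → ℕ) →
           sumArr (λ σ → ∑[ i < m ] f i σ) ≡ ∑[ i < m ] sumArr (f i)
sumArr-∑ {zero}  m f = refl
sumArr-∑ {suc n} m f = trans (sum-cong-≗ λ j → sumArr-∑ m (λ i σ → f i (j ∷ σ)))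
                             (∑-comm λ j i → sumArr (λ σ → f i (j ∷ σ)))

module _ {A : Set} {_∼_ : A → A → Set} where

  insertAt⁺ : ∀ {n x y} {u v : Vec A n} (i : Fin (suc n)) → x ∼ y → Pointwise _∼_ u v →
              Pointwise _∼_ (insertAt u i x) (insertAt v i y)
  insertAt⁺ zero    p ps       = p ∷ ps
  insertAt⁺ (suc i) p (q ∷ ps) = q ∷ insertAt⁺ i p ps

  -- Both words are permuted by the same arrangement, so letters that faced each other still do.
  -- Hence compatible rotations stay compatible in every cyclic order.
  arrange⁺ : ∀ {n} {u v : Vec A n} (σ : Arrangement n) → Pointwise _∼_ u v →
             Pointwise _∼_ (arrange σ u) (arrange σ v)
  arrange⁺ []      []       = []
  arrange⁺ (i ∷ σ) (p ∷ ps) = insertAt⁺ i p (arrange⁺ σ ps)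

-- Counting the arrangements that take one word to another.

module Arrangements {A : Set} (_≟_ : DecidableEquality A) where

  _≟ᵥ_ : ∀ {n} → DecidableEquality (Vec A n)
  _≟ᵥ_ = ≡-dec _≟_

  occurrences : ∀ {n} → A → Vec A n → ℕ
  occurrences x []      = 0
  occurrences x (y ∷ w) = δ (x ≟ y) + occurrences x w

  occurrences-lookup : ∀ {n} x (w : Vec A n) → occurrences x w ≡ ∑[ i < n ] δ (x ≟ lookup w i)
  occurrences-lookup x []      = refl
  occurrences-lookup x (y ∷ w) = cong (δ (x ≟ y) +_) (occurrences-lookup x w)

  occurrences-removeAt : ∀ {n} x (w : Vec A (suc n)) i →
                         occurrences x w ≡ δ (x ≟ lookup w i) + occurrences x (removeAt w i)
  occurrences-removeAt x (y ∷ w)         zero    = refl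
  occurrences-removeAt x (y ∷ w@(_ ∷ _)) (suc i) = begin
    δ (x ≟ y) + occurrences x w
      ≡⟨ cong (δ (x ≟ y) +_) (occurrences-removeAt x w i) ⟩
    δ (x ≟ y) + (δ (x ≟ lookup w i) + occurrences x (removeAt w i))
      ≡⟨ swap (δ (x ≟ y)) (δ (x ≟ lookup w i)) (occurrences x (removeAt w i)) ⟩
    δ (x ≟ lookup w i) + (δ (x ≟ y) + occurrences x (removeAt w i)) ∎
    where
    open ≡-Reasoning
    swap : ∀ p q r → p + (q + r) ≡ q + (p + r)
    swap = solve-∀

  -- The order of the stabiliser of a word under permutations of its places, that is, the product of
  -- the factorials of its letter counts. The recursion follows that of `arrange`.
  multiplicity : ∀ {n} → Vec A n → ℕ
  multiplicity []      = 1
  multiplicity (x ∷ w) = suc (occurrences x w) * multiplicity w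

  -- Insertion and removal at one place are mutually inverse, so the indicator splits into a test of
  -- the new letter and a test of the rest.
  δ-insertAt : ∀ {n} x (u : Vec A n) (v : Vec A (suc n)) i →
               δ (insertAt u i x ≟ᵥ v) ≡ δ (x ≟ lookup v i) * δ (u ≟ᵥ removeAt v i)
  δ-insertAt x u v i = trans
    (δ-⇔ (insertAt u i x ≟ᵥ v) ((x ≟ lookup v i) ×-dec (u ≟ᵥ removeAt v i))
      (λ { refl → sym (insertAt-lookup u i x) , sym (removeAt-insertAt u i x) })
      (λ { (refl , refl) → insertAt-removeAt v i }))
    (δ-× (x ≟ lookup v i) (u ≟ᵥ removeAt v i))

  -- The first letter `x` may go to any occurrence of `x` in `v`, and removing it leaves two words
  -- with equal letter counts again. The result does not depend on `v`: averaging gives all flags of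
  -- one type the same weight.
  arrangements-count : ∀ {n} (w v : Vec A n) → (∀ x → occurrences x w ≡ occurrences x v) →
                       sumArr (λ σ → δ (arrange σ w ≟ᵥ v)) ≡ multiplicity w
  arrangements-count             []      [] eq = refl
  arrangements-count {n = suc n} (x ∷ w) v  eq = begin
    ∑[ i < suc n ] sumArr (λ σ → δ (insertAt (arrange σ w) i x ≟ᵥ v))
      ≡⟨ sum-cong-≗ step ⟩
    ∑[ i < suc n ] (δ (x ≟ lookup v i) * multiplicity w)
      ≡⟨ *-distribʳ-sum (multiplicity w) (λ i → δ (x ≟ lookup v i)) ⟨
    (∑[ i < suc n ] δ (x ≟ lookup v i)) * multiplicity w
      ≡⟨ cong (_* multiplicity w) (occurrences-lookup x v) ⟨
    occurrences x v * multiplicity w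
      ≡⟨ cong (_* multiplicity w) (eq x) ⟨
    (δ (x ≟ x) + occurrences x w) * multiplicity w
      ≡⟨ cong (λ k → (k + occurrences x w) * multiplicity w) (δ-yes (x ≟ x) refl) ⟩
    suc (occurrences x w) * multiplicity w ∎
    where
    open ≡-Reasoning
    rest : ∀ i → δ (x ≟ lookup v i) * sumArr (λ σ → δ (arrange σ w ≟ᵥ removeAt v i))
               ≡ δ (x ≟ lookup v i) * multiplicity w
    rest i with x ≟ lookup v i
    ... | no _     = refl
    -- Cancelling the removed letter from both counts restores the hypothesis of the induction.
    ... | yes refl = cong (1 *_) (arrangements-count w (removeAt v i) λ y →
          +-cancelˡ-≡ (δ (y ≟ x)) _ _ (trans (eq y) (occurrences-removeAt y v i)))
    step : ∀ i → sumArr (λ σ → δ (insertAt (arrange σ w) i x ≟ᵥ v))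
               ≡ δ (x ≟ lookup v i) * multiplicity w
    step i = trans (sumArr-cong λ σ → δ-insertAt x (arrange σ w) v i)
             (trans (sumArr-*ˡ (δ (x ≟ lookup v i)) (λ σ → δ (arrange σ w ≟ᵥ removeAt v i)))
                    (rest i))

-- Flags as words.

-- The word of a flag (A , B) marks the points of A as core, those of B ∖ A as
-- shell and those outside B as outer.

data Letter : Set where
  outer shell core : Letter

_≟ₗ_ : DecidableEquality Letter
outer ≟ₗ outer = yes refl
outer ≟ₗ shell = no λ ()
outer ≟ₗ core  = no λ ()
shell ≟ₗ outer = no λ ()
shell ≟ₗ shell = yes refl
shell ≟ₗ core  = no λ ()
core  ≟ₗ outer = no λ ()
core  ≟ₗ shell = no λ ()
core  ≟ₗ core  = yes refl

open Arrangements _≟ₗ_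

multiplicity-! : ∀ {n} (w : Vec Letter n) →
                 multiplicity w ≡ occurrences outer w ! * (occurrences shell w ! * occurrences core w !)
multiplicity-! []          = refl
multiplicity-! (outer ∷ w) = trans
  (cong (suc (occurrences outer w) *_) (multiplicity-! w))
  (sym (*-assoc (suc (occurrences outer w)) (occurrences outer w !) _))
multiplicity-! (shell ∷ w) = trans
  (cong (suc (occurrences shell w) *_) (multiplicity-! w))
  (shuffle (suc (occurrences shell w)) (occurrences outer w !) (occurrences shell w !) (occurrences core w !))
  where
  shuffle : ∀ m p q r → m * (p * (q * r)) ≡ p * (m * q * r)
  shuffle = solve-∀
multiplicity-! (core ∷ w)  = trans
  (cong (suc (occurrences core w) *_) (multiplicity-! w))
  (shuffle (suc (occurrences core w)) (occurrences outer w !) (occurrences shell w !) (occurrences core w !))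
  where
  shuffle : ∀ m p q r → m * (p * (q * r)) ≡ p * (q * (m * r))
  shuffle = solve-∀

inA inB : Letter → Bool
inA outer = false
inA shell = false
inA core  = true
inB outer = false
inB shell = true
inB core  = true

-- A point of A is read as `core` whatever its second bit; in a flag that bit is `true`.
letter : Bool → Bool → Letter
letter true  _     = core
letter false true  = shell
letter false false = outer

toPair : ∀ {n} → Vec Letter n → Pair n
toPair w = map inA w , map inB w

fromPair : ∀ {n} → Pair n → Vec Letter n
fromPair (A , B) = zipWith letter A B

toPair-fromPair : ∀ {n} (A B : Subset n) → A ⊆ B → toPair (fromPair (A , B)) ≡ (A , B)
toPair-fromPair []          []          A⊆B = refl
toPair-fromPair (s ∷ A) (t ∷ B) A⊆B with toPair-fromPair A B (drop-∷-⊆ A⊆B)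
toPair-fromPair (true  ∷ A) (false ∷ B) A⊆B | _ with () ← A⊆B here
toPair-fromPair (true  ∷ A) (true  ∷ B) A⊆B | eq = cong (λ (X , Y) → true ∷ X , true ∷ Y) eq
toPair-fromPair (false ∷ A) (true  ∷ B) A⊆B | eq = cong (λ (X , Y) → false ∷ X , true ∷ Y) eq
toPair-fromPair (false ∷ A) (false ∷ B) A⊆B | eq = cong (λ (X , Y) → false ∷ X , false ∷ Y) eq

occurrences-fromPair : ∀ {n} (A B : Subset n) → A ⊆ B →
  occurrences core (fromPair (A , B)) ≡ ∣ A ∣
  × occurrences shell (fromPair (A , B)) + ∣ A ∣ ≡ ∣ B ∣
  × occurrences outer (fromPair (A , B)) + ∣ B ∣ ≡ n
occurrences-fromPair []          []          A⊆B = refl , refl , refl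
occurrences-fromPair (s ∷ A) (t ∷ B) A⊆B with occurrences-fromPair A B (drop-∷-⊆ A⊆B)
occurrences-fromPair (true  ∷ A) (false ∷ B) A⊆B | _ with () ← A⊆B here
occurrences-fromPair (true  ∷ A) (true  ∷ B) A⊆B | p , q , r =
  cong suc p , trans (+-suc _ _) (cong suc q) , trans (+-suc _ _) (cong suc r)
occurrences-fromPair (false ∷ A) (true  ∷ B) A⊆B | p , q , r =
  p , cong suc q , trans (+-suc _ _) (cong suc r)
occurrences-fromPair (false ∷ A) (false ∷ B) A⊆B | p , q , r = p , q , cong suc r

-- Adjacency read letter by letter.

data Compatible : Letter → Letter → Set where
  outer-core  : Compatible outer core
  core-outer  : Compatible core outer
  outer-shell : Compatible outer shell
  shell-outer : Compatible shell outer
  shell-shell : Compatible shell shell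

Compatible-sym : ∀ {x y} → Compatible x y → Compatible y x
Compatible-sym outer-core  = core-outer
Compatible-sym core-outer  = outer-core
Compatible-sym outer-shell = shell-outer
Compatible-sym shell-outer = outer-shell
Compatible-sym shell-shell = shell-shell

zipWith-map-const : ∀ {n} (_⊕_ : Bool → Bool → Bool) (f g : Letter → Bool) {k} →
                    (∀ {x y} → Compatible x y → f x ⊕ g y ≡ k) →
                    {u v : Vec Letter n} → Pointwise Compatible u v →
                    zipWith _⊕_ (map f u) (map g v) ≡ replicate n k
zipWith-map-const _⊕_ f g h []       = refl
zipWith-map-const _⊕_ f g h (p ∷ ps) = cong₂ _∷_ (h p) (zipWith-map-const _⊕_ f g h ps)

-- `Compatible` excludes outer against outer, which makes B ∪ B′ everything, and lets core meet only
-- outer, which makes A disjoint from B′ and A′ from B. The disjointness of A and A′ is included in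
-- this.
Compatible⇒Adj : ∀ {n} {u v : Vec Letter n} → Pointwise Compatible u v → Adj (toPair u) (toPair v)
Compatible⇒Adj ps =
    inj₂ (zipWith-map-const _∧_ inA inA
      (λ { outer-core → refl ; core-outer → refl ; outer-shell → refl ; shell-outer → refl ; shell-shell → refl }) ps)
  , inj₂ (zipWith-map-const _∧_ inA inB
      (λ { outer-core → refl ; core-outer → refl ; outer-shell → refl ; shell-outer → refl ; shell-shell → refl }) ps)
  , inj₂ (zipWith-map-const _∧_ inB inA
      (λ { outer-core → refl ; core-outer → refl ; outer-shell → refl ; shell-outer → refl ; shell-shell → refl }) ps)
  , inj₁ (zipWith-map-const _∨_ inB inB
      (λ { outer-core → refl ; core-outer → refl ; outer-shell → refl ; shell-outer → refl ; shell-shell → refl }) ps)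

-- Independent families contain at most one of two compatible words.

occ : ∀ {n} → List (Pair n) → Vec Letter n → ℕ
occ []      w = 0
occ (v ∷ S) w = δ (w ≟ᵥ fromPair v) + occ S w

occ-none : ∀ {n} {S : List (Pair n)} {w} → All (λ v → w ≢ fromPair v) S → occ S w ≡ 0
occ-none             []       = refl
occ-none {S = v ∷ S} {w} (p ∷ ps) = cong₂ _+_ (δ-no (w ≟ᵥ fromPair v) p) (occ-none ps)

∣X∣+∣Y∣≤n : ∀ {n} (X Y : Subset n) → X ∩ Y ≡ ⊥ → ∣ X ∣ + ∣ Y ∣ ≤ n
∣X∣+∣Y∣≤n []          []          eq = z≤n
∣X∣+∣Y∣≤n (true  ∷ X) (false ∷ Y) eq = s≤s (∣X∣+∣Y∣≤n X Y (∷-injectiveʳ eq))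
∣X∣+∣Y∣≤n (false ∷ X) (false ∷ Y) eq = m≤n⇒m≤1+n (∣X∣+∣Y∣≤n X Y (∷-injectiveʳ eq))
∣X∣+∣Y∣≤n (false ∷ X) (true  ∷ Y) eq =
  ≤-trans (≤-reflexive (+-suc _ _)) (s≤s (∣X∣+∣Y∣≤n X Y (∷-injectiveʳ eq)))

module _ {n a b : ℕ} (n<2b : n < 2 * b) where

  -- Two disjoint sets of size `b` would require 2b ≤ n, so general position of B and B′ can only
  -- mean covering.
  flags-cover : ∀ {u v : Pair n} → IsFlag a b u → IsFlag a b v → Adj u v → proj₂ u ∪ proj₂ v ≡ ⊤
  flags-cover _ _ (_ , _ , _ , inj₁ cover) = cover
  flags-cover {_ , B} {_ , B′} (_ , _ , ∣B∣≡b) (_ , _ , ∣B′∣≡b) (_ , _ , _ , inj₂ disjoint) =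
    contradiction (∣X∣+∣Y∣≤n B B′ disjoint) (<⇒≱ (<-≤-trans n<2b (≤-reflexive
      (trans (cong (b +_) (+-identityʳ b)) (sym (cong₂ _+_ ∣B∣≡b ∣B′∣≡b))))))

  module _ (b<n : b < n) where

    -- `AllPairs` does not compare an entry with itself, so loops are excluded here: B ∪ B = B is
    -- not all of [n] when b < n.
    Adj-irrefl : ∀ {v : Pair n} → IsFlag a b v → ¬ Adj v v
    Adj-irrefl {A , B} flag@(_ , _ , ∣B∣≡b) adj = <⇒≢ b<n (begin
      b       ≡⟨ ∣B∣≡b ⟨
      ∣ B ∣   ≡⟨ cong ∣_∣ (trans (sym (∪-idem B)) (flags-cover flag flag adj)) ⟩
      ∣ ⊤ {n} ∣ ≡⟨ ∣⊤∣≡n n ⟩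
      n       ∎)
      where open ≡-Reasoning

    flag-word : ∀ {v : Pair n} {w} → IsFlag a b v → w ≡ fromPair v → toPair w ≡ v
    flag-word {A , B} (A⊆B , _) refl = toPair-fromPair A B A⊆B

    -- The word of `v` matches no later entry because the entries are distinct. The word `w′`
    -- encodes a neighbour of `v`, so it matches neither `v` nor any later entry.
    occ-head : ∀ {v : Pair n} {S w w′} → IsFlag a b v → All (IsFlag a b) S →
               All (v ≢_) S → All (λ u → ¬ Adj v u) S →
               Pointwise Compatible w w′ → w ≡ fromPair v →
               occ (v ∷ S) w ≡ 1 × occ (v ∷ S) w′ ≡ 0
    occ-head {v} {S} {w} {w′} fv fS v≢S v≁S w∼w′ w≡ =
        cong₂ _+_ (δ-yes (w ≟ᵥ fromPair v) w≡)
                  (occ-none (All.zipWith (λ (fu , v≢u) w≡u → v≢u (trans (sym (flag-word fv w≡)) (flag-word fu w≡u))) (fS , v≢S)))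
      , occ-none {S = v ∷ S} (not-adjacent fv (Adj-irrefl fv) ∷ All.zipWith (λ (fu , v≁u) → not-adjacent fu v≁u) (fS , v≁S))
      where
      not-adjacent : ∀ {u} → IsFlag a b u → ¬ Adj v u → w′ ≢ fromPair u
      not-adjacent fu v≁u w′≡u =
        v≁u (subst₂ Adj (flag-word fv w≡) (flag-word fu w′≡u) (Compatible⇒Adj w∼w′))

    occ-Compatible : ∀ {S : List (Pair n)} {w w′} → IsIndependent a b S →
                     Pointwise Compatible w w′ → occ S w + occ S w′ ≤ 1
    occ-Compatible {[]} _ _ = z≤n
    occ-Compatible {v ∷ S} {w} {w′} (fv ∷ fS , v≢S ∷ uS , v≁S ∷ iS) w∼w′
      with w ≟ᵥ fromPair v | w′ ≟ᵥ fromPair v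
         -- Either word may be the one that matches `v`, so `occ-head` is taken in both directions.
         -- It is abstracted together with the tests so that its counts reduce along with the goal.
         | occ-head {w = w} {w′} fv fS v≢S v≁S w∼w′
         | occ-head {w = w′} {w} fv fS v≢S v≁S (Pointwise.sym Compatible-sym w∼w′)
    ... | yes p | _     | h | _ = ≤-reflexive (cong₂ _+_ (proj₁ (h p)) (proj₂ (h p)))
    ... | no _  | yes q | _ | h = ≤-reflexive (cong₂ _+_ (proj₂ (h q)) (proj₁ (h q)))
    ... | no _  | no _  | _ | _ = occ-Compatible (fS , uS , iS) w∼w′

-- Each member of `S` has the letter counts of `w` and is therefore reached by exactly
-- `multiplicity w` arrangements.
sumArr-occ : ∀ {n} {P : Pair n → Set} {S : List (Pair n)} (w : Vec Letter n) →
             (∀ {v} → P v → ∀ x → occurrences x w ≡ occurrences x (fromPair v)) → All P S →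
             sumArr (λ σ → occ S (arrange σ w)) ≡ length S * multiplicity w
sumArr-occ {n} w eq []       = trans (sumArr-const n 0) (*-zeroʳ (n !))
sumArr-occ {S = v ∷ S} w eq (p ∷ ps) =
  trans (sumArr-+ (λ σ → δ (arrange σ w ≟ᵥ fromPair v)) (λ σ → occ S (arrange σ w)))
        (cong₂ _+_ (arrangements-count w (fromPair v) (eq p)) (sumArr-occ w eq ps))

-- Katona's bound on a cycle.

sum-+ : ∀ m k (f : ℕ → ℕ) →
        ∑[ i < m + k ] f (toℕ i) ≡ ∑[ i < m ] f (toℕ i) + ∑[ i < k ] f (m + toℕ i)
sum-+ zero    k f = refl
sum-+ (suc m) k f = trans (cong (f 0 +_) (sum-+ m k (f ∘ suc))) (sym (+-assoc (f 0) _ _))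

-- Moving the window by one place trades `f 0` for `f n`, and these are equal.
sum-periodic : ∀ n (f : ℕ → ℕ) → (∀ i → f (i + n) ≡ f i) →
               ∀ s → ∑[ i < n ] f (s + toℕ i) ≡ ∑[ i < n ] f (toℕ i)
sum-periodic n f per zero    = refl
sum-periodic n f per (suc s) =
  trans (sum-periodic n (f ∘ suc) (per ∘ suc) s) (+-cancelˡ-≡ (f 0) _ _ (begin
    ∑[ i < suc n ] f (toℕ i)             ≡⟨ cong (λ m → ∑[ i < m ] f (toℕ i)) (+-comm 1 n) ⟩
    ∑[ i < n + 1 ] f (toℕ i)             ≡⟨ sum-+ n 1 f ⟩
    ∑[ i < n ] f (toℕ i) + (f (n + 0) + 0) ≡⟨ cong (∑[ i < n ] f (toℕ i) +_) (trans (+-identityʳ _) (trans (cong f (+-identityʳ n)) (per 0))) ⟩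
    ∑[ i < n ] f (toℕ i) + f 0           ≡⟨ +-comm _ (f 0) ⟩
    f 0 + ∑[ i < n ] f (toℕ i)           ∎))
  where open ≡-Reasoning

-- Arcs have length k = 1 + c.  If g 0 ≠ 0 then g vanishes on [k , n ∸ k], and
-- the remaining places other than 0 pair up as t and t + (n ∸ k).
cyclic-bound-at-0 : ∀ c m (g : ℕ → ℕ) → let n = suc c + (suc m + c) in
  (∀ i s → suc c ≤ s → s + suc c ≤ n → g i + g (s + i) ≤ 1) →
  1 ≤ g 0 → ∑[ i < n ] g (toℕ i) ≤ suc c
cyclic-bound-at-0 c m g disj 1≤g0 = begin
  g 0 + ∑[ t < c + (suc m + c) ] g (suc (toℕ t))
    ≡⟨ cong (g 0 +_) (trans (sum-+ c (suc m + c) (g ∘ suc))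
                            (cong (∑[ t < c ] g (suc (toℕ t)) +_) (sum-+ (suc m) c (λ i → g (suc c + i))))) ⟩
  g 0 + (front + (middle + back))
    ≡⟨ shuffle (g 0) front middle back ⟩
  (g 0 + middle) + (front + back)
    ≤⟨ +-mono-≤ g0+middle≤1 front+back≤c ⟩
  suc c ∎
  where
  open ≤-Reasoning
  n = suc c + (suc m + c)
  front  = ∑[ t < c ] g (suc (toℕ t))
  middle = ∑[ t < suc m ] g (suc c + toℕ t)
  back   = ∑[ t < c ] g (suc c + (suc m + toℕ t))
  shuffle : ∀ x p q r → x + (p + (q + r)) ≡ (x + q) + (p + r)
  shuffle = solve-∀
  short : ∀ t → t ≤ m → (suc c + t) + suc c ≤ n
  short t t≤m = ≤-trans (≤-reflexive (trans (+-assoc (suc c) t (suc c)) (cong (suc c +_) (+-suc t c))))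
                        (+-monoʳ-≤ (suc c) (+-monoˡ-≤ c (s≤s t≤m)))
  far-zero : ∀ t → t ≤ m → g (suc c + t) ≤ 0
  far-zero t t≤m = +-cancelˡ-≤ 1 _ _ (begin
    1 + g (suc c + t)         ≤⟨ +-monoˡ-≤ _ 1≤g0 ⟩
    g 0 + g (suc c + t)       ≡⟨ cong (λ s → g 0 + g s) (+-identityʳ (suc c + t)) ⟨
    g 0 + g (suc c + t + 0)   ≤⟨ disj 0 (suc c + t) (m≤m+n (suc c) t) (short t t≤m) ⟩
    1                         ∎)
  middle≤0 : middle ≤ 0
  middle≤0 = begin
    middle                    ≤⟨ sum-mono {suc m} _ (const 0) (λ t → far-zero (toℕ t) (toℕ≤pred[n] t)) ⟩
    sum {suc m} (const 0)     ≡⟨ sum-replicate-zero (suc m) ⟩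
    0                         ∎
  g0+middle≤1 : g 0 + middle ≤ 1
  g0+middle≤1 = begin
    -- As `middle` vanishes, any value of `g` may replace it; the value at `suc c` is chosen, where
    -- disjointness from place 0 gives the bound 1.
    g 0 + middle              ≤⟨ +-monoʳ-≤ (g 0) (≤-trans middle≤0 z≤n) ⟩
    g 0 + g (suc c + 0 + 0)   ≤⟨ disj 0 (suc c + 0) (m≤m+n (suc c) 0) (short 0 z≤n) ⟩
    1                         ∎
  pair : ∀ t → g (suc t) + g (suc c + (suc m + t)) ≤ 1
  -- The shift is `suc c + m`, which is n ∸ k and the largest that `disj` admits.
  pair t = subst (λ s → g (suc t) + g s ≤ 1) (rearrange c m t)
             (disj (suc t) (suc c + m) (m≤m+n (suc c) m) (short m ≤-refl))
    where
    rearrange : ∀ c m t → (suc c + m) + suc t ≡ suc c + (suc m + t)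
    rearrange = solve-∀
  front+back≤c : front + back ≤ c
  front+back≤c = begin
    front + back
      ≡⟨ ∑-distrib-+ {c} (λ t → g (suc (toℕ t))) (λ t → g (suc c + (suc m + toℕ t))) ⟨
    ∑[ t < c ] (g (suc (toℕ t)) + g (suc c + (suc m + toℕ t)))
      ≤⟨ sum-mono {c} _ (const 1) (λ t → pair (toℕ t)) ⟩
    sum {c} (const 1)
      ≡⟨ trans (sum-const c 1) (*-identityʳ c) ⟩
    c ∎

-- Either `g` vanishes on the whole cycle, or the cycle is turned until a place with nonzero value
-- becomes place 0.
cyclic-bound : ∀ c n (g : ℕ → ℕ) → suc c + suc c ≤ n → (∀ i → g (i + n) ≡ g i) →
  (∀ i s → suc c ≤ s → s + suc c ≤ n → g i + g (s + i) ≤ 1) →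
  ∑[ i < n ] g (toℕ i) ≤ suc c
cyclic-bound c n g 2c≤n per disj with any? (λ (i : Fin n) → 1 ≤? g (toℕ i))
... | no none = begin
    ∑[ i < n ] g (toℕ i) ≤⟨ sum-mono {n} _ (const 0) (λ i → ≤-pred (≰⇒> λ 1≤gi → none (i , 1≤gi))) ⟩
    sum {n} (const 0)    ≡⟨ sum-replicate-zero n ⟩
    0                    ≤⟨ z≤n ⟩
    suc c                ∎
  where open ≤-Reasoning
... | yes (i₀ , 1≤g) = ≤-trans (≤-reflexive (sym (sum-periodic n g per s)))
      (subst (λ n → ∑[ i < n ] g (s + toℕ i) ≤ suc c) n≡ (cyclic-bound-at-0 c (n ∸ (suc c + suc c)) (λ i → g (s + i))
        (λ i t c≤t t+c≤n → subst (λ j → g (s + i) + g j ≤ 1) (swap t s i)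
                              (disj (s + i) t c≤t (≤-trans t+c≤n (≤-reflexive n≡))))
        (subst (λ j → 1 ≤ g j) (sym (+-identityʳ s)) 1≤g)))
  where
  s = toℕ i₀
  swap : ∀ t s i → t + (s + i) ≡ s + (t + i)
  swap = solve-∀
  shuffle : ∀ c m → suc c + (suc m + c) ≡ suc c + suc c + m
  shuffle = solve-∀
  n≡ : suc c + (suc (n ∸ (suc c + suc c)) + c) ≡ n
  n≡ = trans (shuffle c _) (m+[n∸m]≡n 2c≤n)

-- The cyclic word of a flag and its rotations.

block : {A : Set} → ℕ → A → (ℕ → A) → ℕ → A
block zero    x f t       = f t
block (suc m) x f zero    = x
block (suc m) x f (suc t) = block m x f t

block-< : ∀ {A : Set} m (x : A) f {t} → t < m → block m x f t ≡ x
block-< (suc m) x f {zero}  t<m       = refl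
block-< (suc m) x f {suc t} (s≤s t<m) = block-< m x f t<m

block-+ : ∀ {A : Set} m (x : A) f t → block m x f (m + t) ≡ f t
block-+ zero    x f t = refl
block-+ (suc m) x f t = block-+ m x f t

sum-block : ∀ {A : Set} m k (x : A) f (h : A → ℕ) →
            ∑[ i < m + k ] h (block m x f (toℕ i)) ≡ m * h x + ∑[ i < k ] h (f (toℕ i))
sum-block zero    k x f h = refl
sum-block (suc m) k x f h = trans (cong (h x +_) (sum-block m k x f h)) (sym (+-assoc (h x) _ _))

occurrences-tabulate : ∀ n x (f : ℕ → Letter) →
  occurrences x (tabulate {n = n} (f ∘ toℕ)) ≡ ∑[ i < n ] δ (x ≟ₗ f (toℕ i))
occurrences-tabulate zero    x f = refl
occurrences-tabulate (suc n) x f = cong (δ (x ≟ₗ f 0) +_) (occurrences-tabulate n x (f ∘ suc))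

-- In cyclic order: 1 + c outer letters, followed by a flag whose a core letters
-- are flanked by d₁ and d₂ shell letters.
module Rotations (c d₁ a d₂ : ℕ) (d₁+a≤c : d₁ + a ≤ suc c) (a+d₂≤c : a + d₂ ≤ suc c) where

  private
    b = d₁ + (a + d₂)
    n = suc c + b

  base : ℕ → Letter
  base = block (suc c) outer (block d₁ shell (block a core (const shell)))

  -- The two shell runs share one constructor: for a shell place it is enough to know that it lies
  -- beyond the outer run.
  data Zone (t : ℕ) : Set where
    outer-zone : base t ≡ outer → t < suc c → Zone t
    shell-zone : base t ≡ shell → suc c ≤ t → Zone t
    core-zone  : base t ≡ core → suc c + d₁ ≤ t → t < suc c + (d₁ + a) → Zone t

  zone : ∀ t → Zone t
  zone t with t <? suc c
  ... | yes t<c = outer-zone (block-< (suc c) outer _ t<c) t<c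
  ... | no  t≮c with (u , refl) ← m≤n⇒∃[o]m+o≡n (≮⇒≥ t≮c) with u <? d₁
  ...   | yes u<d = shell-zone (trans (block-+ (suc c) outer _ u) (block-< d₁ shell _ u<d)) (m≤m+n (suc c) u)
  ...   | no  u≮d with (v , refl) ← m≤n⇒∃[o]m+o≡n (≮⇒≥ u≮d) with v <? a
  ...     | yes v<a = core-zone
              (trans (block-+ (suc c) outer _ u) (trans (block-+ d₁ shell _ v) (block-< a core _ v<a)))
              (+-monoʳ-≤ (suc c) (m≤m+n d₁ v)) (+-monoʳ-< (suc c) (+-monoʳ-< d₁ v<a))
  ...     | no  v≮a with (w , refl) ← m≤n⇒∃[o]m+o≡n (≮⇒≥ v≮a) = shell-zone
              (trans (block-+ (suc c) outer _ u) (trans (block-+ d₁ shell _ v) (block-+ a core _ w)))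
              (m≤m+n (suc c) u)

  -- This is the case without wraparound. A shift by at least `suc c` leaves the outer run. From a
  -- shell place it reaches 2 * `suc c` or further, past the core because d₁ + a ≤ `suc c`. From a
  -- core place it would reach `n` or further because a + d₂ ≤ `suc c`.
  base-Compatible : ∀ s t → suc c ≤ s → s + t < n → Compatible (base t) (base (s + t))
  base-Compatible s t c≤s s+t<n with zone t | zone (s + t)
  ... | outer-zone p _   | shell-zone q _   = subst₂ Compatible (sym p) (sym q) outer-shell
  ... | outer-zone p _   | core-zone q _ _  = subst₂ Compatible (sym p) (sym q) outer-core
  ... | shell-zone p _   | shell-zone q _   = subst₂ Compatible (sym p) (sym q) shell-shell
  ... | _                | outer-zone _ s+t<c = contradiction (≤-trans c≤s (m≤m+n s t)) (<⇒≱ s+t<c)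
  ... | shell-zone _ c≤t | core-zone _ _ s+t< = contradiction
          (≤-trans (+-monoʳ-≤ (suc c) d₁+a≤c) (+-mono-≤ c≤s c≤t)) (<⇒≱ s+t<)
  ... | core-zone _ d≤t _ | _ = contradiction (begin
          suc c + (d₁ + (a + d₂)) ≤⟨ +-monoʳ-≤ (suc c) (+-monoʳ-≤ d₁ a+d₂≤c) ⟩
          suc c + (d₁ + suc c)    ≡⟨ cong (suc c +_) (+-comm d₁ (suc c)) ⟩
          suc c + (suc c + d₁)    ≤⟨ +-mono-≤ c≤s d≤t ⟩
          s + t                   ∎) (<⇒≱ s+t<n)
    where open ≤-Reasoning

  periodic : ℕ → Letter
  periodic t = base (t % n)

  periodic-+ : ∀ t → periodic (t + n) ≡ periodic t
  periodic-+ t = cong base ([m+n]%n≡m%n t n)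

  periodic-Compatible : ∀ s t → suc c ≤ s → s + suc c ≤ n → Compatible (periodic t) (periodic (s + t))
  periodic-Compatible s t c≤s s+c≤n = subst (λ u → Compatible (base r) (base u)) (sym s+t%n) (compatible (s + r <? n))
    where
    r = t % n
    r<n : r < n
    r<n = m%n<n t n
    s≤n : s ≤ n
    s≤n = m+n≤o⇒m≤o s s+c≤n
    s+t%n : (s + t) % n ≡ (s + r) % n
    s+t%n = begin
      (s + t) % n           ≡⟨ cong (λ u → (s + u) % n) (m≡m%n+[m/n]*n t n) ⟩
      (s + (r + q * n)) % n ≡⟨ cong (_% n) (+-assoc s r (q * n)) ⟨
      (s + r + q * n) % n   ≡⟨ [m+kn]%n≡m%n (s + r) q n ⟩
      (s + r) % n           ∎
      where
      open ≡-Reasoning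
      q = t / n
    compatible : Dec (s + r < n) → Compatible (base r) (base ((s + r) % n))
    compatible (yes s+r<n) = subst (λ u → Compatible (base r) (base u)) (sym (m<n⇒m%n≡m s+r<n))
                                   (base-Compatible s r c≤s s+r<n)
    -- After wraparound the second place `u` precedes `r`, and `r` is `u` shifted by `n ∸ s`. This
    -- shift is again at least `suc c`, so the previous case applies with the two places exchanged.
    compatible (no  s+r≮n) = Compatible-sym (subst₂ (λ x y → Compatible (base x) (base y)) (sym wrap) back
        (base-Compatible (n ∸ s) u (m+n≤o⇒m≤o∸n (suc c) (≤-trans (≤-reflexive (+-comm (suc c) s)) s+c≤n)) (≤-trans (≤-reflexive (cong suc back)) r<n)))
      where
      u = s + r ∸ n
      n+u : n + u ≡ s + r
      n+u = m+[n∸m]≡n (≮⇒≥ s+r≮n)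
      u<n : u < n
      u<n = +-cancelˡ-< n u n (≤-trans (s≤s (≤-reflexive n+u)) (+-mono-≤-< s≤n r<n))
      wrap : (s + r) % n ≡ u
      wrap = trans (cong (_% n) (trans (sym n+u) (+-comm n u))) (trans ([m+n]%n≡m%n u n) (m<n⇒m%n≡m u<n))
      back : (n ∸ s) + u ≡ r
      back = +-cancelˡ-≡ s _ _ (trans (sym (+-assoc s (n ∸ s) u)) (trans (cong (_+ u) (m+[n∸m]≡n s≤n)) n+u))

  rotation : ℕ → Vec Letter n
  rotation i = tabulate {n = n} λ j → periodic (i + toℕ j)

  rotation-+ : ∀ i → rotation (i + n) ≡ rotation i
  rotation-+ i = tabulate-cong {n = n} λ j →
    trans (cong periodic (shuffle i n (toℕ j))) (periodic-+ (i + toℕ j))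
    where
    shuffle : ∀ i n j → i + n + j ≡ i + j + n
    shuffle = solve-∀

  rotation-Compatible : ∀ i s → suc c ≤ s → s + suc c ≤ n →
                        Pointwise Compatible (rotation i) (rotation (s + i))
  rotation-Compatible i s c≤s s+c≤n = Pointwise.tabulate⁺ {n = n} λ j →
    subst (λ u → Compatible (periodic (i + toℕ j)) (periodic u)) (sym (+-assoc s i (toℕ j)))
          (periodic-Compatible s (i + toℕ j) c≤s s+c≤n)

  occurrences-rotation : ∀ i x → occurrences x (rotation i) ≡
    suc c * δ (x ≟ₗ outer) + (d₁ * δ (x ≟ₗ shell) + (a * δ (x ≟ₗ core) + d₂ * δ (x ≟ₗ shell)))
  occurrences-rotation i x = begin
    occurrences x (rotation i)
      ≡⟨ occurrences-tabulate n x (λ j → periodic (i + j)) ⟩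
    ∑[ j < n ] h (periodic (i + toℕ j))
      -- A count over a full period does not depend on where the rotation starts.
      ≡⟨ sum-periodic n (h ∘ periodic) (cong h ∘ periodic-+) i ⟩
    ∑[ j < n ] h (periodic (toℕ j))
      ≡⟨ sum-cong-≗ {n} (λ j → cong (h ∘ base) (m<n⇒m%n≡m (toℕ<n j))) ⟩
    ∑[ j < n ] h (base (toℕ j))
      ≡⟨ sum-block (suc c) (d₁ + (a + d₂)) outer _ h ⟩
    suc c * h outer + ∑[ j < d₁ + (a + d₂) ] h (block d₁ shell (block a core (const shell)) (toℕ j))
      ≡⟨ cong (suc c * h outer +_) (trans (sum-block d₁ (a + d₂) shell _ h) (cong (d₁ * h shell +_)
           (trans (sum-block a d₂ core _ h) (cong (a * h core +_) (sum-const d₂ (h shell)))))) ⟩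
    suc c * h outer + (d₁ * h shell + (a * h core + d₂ * h shell)) ∎
    where
    open ≡-Reasoning
    h : Letter → ℕ
    h y = δ (x ≟ₗ y)

  occurrences-outer : ∀ i → occurrences outer (rotation i) ≡ suc c
  occurrences-outer i = trans (occurrences-rotation i outer) (simplify c d₁ a d₂)
    where
    simplify : ∀ c d₁ a d₂ → suc c * 1 + (d₁ * 0 + (a * 0 + d₂ * 0)) ≡ suc c
    simplify = solve-∀

  occurrences-shell : ∀ i → occurrences shell (rotation i) ≡ d₁ + d₂
  occurrences-shell i = trans (occurrences-rotation i shell) (simplify c d₁ a d₂)
    where
    simplify : ∀ c d₁ a d₂ → suc c * 0 + (d₁ * 1 + (a * 0 + d₂ * 1)) ≡ d₁ + d₂
    simplify = solve-∀

  occurrences-core : ∀ i → occurrences core (rotation i) ≡ a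
  occurrences-core i = trans (occurrences-rotation i core) (simplify c d₁ a d₂)
    where
    simplify : ∀ c d₁ a d₂ → suc c * 0 + (d₁ * 0 + (a * 1 + d₂ * 0)) ≡ a
    simplify = solve-∀

  -- The sizes a, b and n determine all three letter counts, so every flag of this type is a
  -- rearrangement of every rotation.
  occurrences-flag : ∀ i {v : Pair n} → IsFlag a b v → ∀ x → occurrences x (rotation i) ≡ occurrences x (fromPair v)
  occurrences-flag i {A , B} (A⊆B , ∣A∣≡a , ∣B∣≡b) x with occurrences-fromPair A B A⊆B
  occurrences-flag i {A , B} (A⊆B , ∣A∣≡a , ∣B∣≡b) core | p , q , r =
    trans (occurrences-core i) (trans (sym ∣A∣≡a) (sym p))
  occurrences-flag i {A , B} (A⊆B , ∣A∣≡a , ∣B∣≡b) shell | p , q , r =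
    trans (occurrences-shell i) (+-cancelʳ-≡ a _ _ (trans (shuffle d₁ d₂ a)
      (trans (sym ∣B∣≡b) (trans (sym q) (cong (occurrences shell (fromPair (A , B)) +_) ∣A∣≡a)))))
    where
    shuffle : ∀ d e a → d + e + a ≡ d + (a + e)
    shuffle = solve-∀
  occurrences-flag i {A , B} (A⊆B , ∣A∣≡a , ∣B∣≡b) outer | p , q , r =
    trans (occurrences-outer i) (+-cancelʳ-≡ b _ _
      (trans (sym r) (cong (occurrences outer (fromPair (A , B)) +_) ∣B∣≡b)))

  -- The order of the stabiliser of a flag, (n - b)! (b - a)! a!.
  M : ℕ
  M = suc c ! * ((d₁ + d₂) ! * a !)

  multiplicity-rotation : ∀ i → multiplicity (rotation i) ≡ M
  multiplicity-rotation i = trans (multiplicity-! (rotation i))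
    (cong₂ _*_ (cong _! (occurrences-outer i))
               (cong₂ (λ p q → p ! * q !) (occurrences-shell i) (occurrences-core i)))

  -- Both sides estimate the number of pairs of a rotation and an arrangement whose result lies in
  -- `S`. Each rotation contributes exactly `length S * M`; each arrangement contributes at most
  -- `suc c` by `cyclic-bound`.
  double-count : n < 2 * b → ∀ {S : List (Pair n)} → IsIndependent a b S →
                 n * (length S * M) ≤ n ! * suc c
  double-count n<2b {S} ind@(flags , _) = begin
    n * (length S * M)
      ≡⟨ sum-const n (length S * M) ⟨
    ∑[ i < n ] (length S * M)
      ≡⟨ sum-cong-≗ {n} (λ i → trans
           (sumArr-occ (rotation (toℕ i)) (occurrences-flag (toℕ i)) flags)
           (cong (length S *_) (multiplicity-rotation (toℕ i)))) ⟨
    ∑[ i < n ] sumArr (λ σ → occ S (arrange σ (rotation (toℕ i))))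
      ≡⟨ sumArr-∑ n (λ i σ → occ S (arrange σ (rotation (toℕ i)))) ⟨
    sumArr (λ σ → ∑[ i < n ] occ S (arrange σ (rotation (toℕ i))))
      ≤⟨ sumArr-mono (λ σ → cyclic-bound c n (λ i → occ S (arrange σ (rotation i))) 2c≤n
           (λ i → cong (λ w → occ S (arrange σ w)) (rotation-+ i))
           (λ i s c≤s s+c≤n → occ-Compatible n<2b (m<n+m b {suc c} (s≤s z≤n)) ind
                                (arrange⁺ σ (rotation-Compatible i s c≤s s+c≤n)))) ⟩
    sumArr {n} (const (suc c))
      ≡⟨ sumArr-const n (suc c) ⟩
    n ! * suc c ∎
    where
    open ≤-Reasoning
    2c≤n : suc c + suc c ≤ n
    -- Here n = `suc c` + b < 2b, hence `suc c` < b.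
    2c≤n = +-monoʳ-≤ (suc c) (<⇒≤ (+-cancelʳ-< b (suc c) b
             (<-≤-trans n<2b (≤-reflexive (cong (b +_) (+-identityʳ b))))))

-- From the double count to binomial coefficients.

nCk*k!*m! : ∀ m k → ((m + k) C k) * (k ! * m !) ≡ (m + k) !
nCk*k!*m! m k = begin
  ((m + k) C k) * (k ! * m !)
    ≡⟨ cong (λ j → ((m + k) C k) * (k ! * j !)) (m+n∸n≡m m k) ⟨
  ((m + k) C k) * (k ! * (m + k ∸ k) !)
    ≡⟨ cong (_* (k ! * (m + k ∸ k) !)) (nCk≡n!/k![n-k]! k≤m+k) ⟩
  ((m + k) ! / (k ! * (m + k ∸ k) !)) * (k ! * (m + k ∸ k) !)
    ≡⟨ m/n*n≡m (k![n∸k]!∣n! k≤m+k) ⟩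
  (m + k) ! ∎
  where
  open ≡-Reasoning
  instance _ = k !* (m + k ∸ k) !≢0
  k≤m+k = m≤n+m k m

-- The claimed bound times `n * M` is exactly `n ! * suc c`, so cancelling `n * M` in `double-count`
-- gives it without rounding.
length-bound : ∀ c d₁ a d₂ → let b = d₁ + (a + d₂) ; n = suc c + b in
  d₁ + a ≤ suc c → a + d₂ ≤ suc c → n < 2 * b →
  ∀ (S : List (Pair n)) → IsIndependent a b S → length S ≤ ((n ∸ 1) C b) * (b C a)
length-bound c d₁ a d₂ d₁+a≤c a+d₂≤c n<2b S ind =
  *-cancelʳ-≤ (length S) T (n * M) {{m*n≢0 n M {{_}} {{M≢0}}}} (begin
    length S * (n * M)   ≡⟨ swap (length S) n M ⟩
    n * (length S * M)   ≤⟨ double-count n<2b ind ⟩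
    n ! * suc c          ≡⟨ total ⟨
    T * (n * M)          ∎)
  where
  open ≤-Reasoning
  open Rotations c d₁ a d₂ d₁+a≤c a+d₂≤c
  b = d₁ + (a + d₂)
  e = d₁ + d₂
  n = suc c + b
  T = ((c + b) C b) * (b C a)
  M≢0 : NonZero M
  M≢0 = m*n≢0 (suc c !) (e ! * a !) {{suc c !≢0}} {{e !* a !≢0}}
  swap : ∀ x y z → x * (y * z) ≡ y * (x * z)
  swap = solve-∀
  b≡e+a : b ≡ e + a
  b≡e+a = shuffle d₁ a d₂
    where
    shuffle : ∀ d a e → d + (a + e) ≡ d + e + a
    shuffle = solve-∀
  bCa : (b C a) * (a ! * e !) ≡ b !
  bCa = trans (cong (λ b → (b C a) * (a ! * e !)) b≡e+a)
              (trans (nCk*k!*m! e a) (cong _! (sym b≡e+a)))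
  total : T * (n * M) ≡ n ! * suc c
  total = begin-equality
    T * (n * M)
      -- The factor `suc c !` of `M` is unfolded to `suc c * c !`. The remaining factorials then
      -- merge first into `b !` and next into `(c + b) !`, which `n` completes to `n !`.
      ≡⟨ gather ((c + b) C b) (b C a) n (suc c) (c !) (e !) (a !) ⟩
    n * (((c + b) C b) * (((b C a) * (a ! * e !)) * c !)) * suc c
      ≡⟨ cong (λ k → n * (((c + b) C b) * (k * c !)) * suc c) bCa ⟩
    n * (((c + b) C b) * (b ! * c !)) * suc c
      ≡⟨ cong (λ k → n * k * suc c) (nCk*k!*m! c b) ⟩
    n ! * suc c ∎
    where
    gather : ∀ x y n s p q r → x * y * (n * (s * p * (q * r))) ≡ n * (x * ((y * (r * q)) * p)) * s
    gather = solve-∀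

-- The star of flags that attains the bound.

extend : ∀ {n} → Bool → Bool → Pair n → Pair (suc n)
extend s t (A , B) = s ∷ A , t ∷ B

extend-injective : ∀ {n s t} {u v : Pair n} → extend s t u ≡ extend s t v → u ≡ v
extend-injective refl = refl

module _ {n a b : ℕ} where

  IsFlag-outer : {v : Pair n} → IsFlag a b v → IsFlag a b (extend false false v)
  IsFlag-outer (A⊆B , p , q) = out⊆ A⊆B , p , q

  IsFlag-shell : {v : Pair n} → IsFlag a b v → IsFlag a (suc b) (extend false true v)
  IsFlag-shell (A⊆B , p , q) = out⊆ A⊆B , p , cong suc q

  IsFlag-core : {v : Pair n} → IsFlag a b v → IsFlag (suc a) (suc b) (extend true true v)
  IsFlag-core (A⊆B , p , q) = s⊆s A⊆B , cong suc p , cong suc q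

-- The cases are the letter of the first point: outer, shell or core. With `b` zero only outer
-- remains; with `a` zero core drops out.
flags : ∀ n → ℕ → ℕ → List (Pair n)
flags zero    a       (suc b) = []
flags zero    zero    zero    = ([] , []) ∷ []
flags zero    (suc a) zero    = []
flags (suc n) a       zero    = List.map (extend false false) (flags n a zero)
flags (suc n) zero    (suc b) = List.map (extend false false) (flags n zero (suc b))
                             ++ List.map (extend false true) (flags n zero b)
flags (suc n) (suc a) (suc b) = List.map (extend false false) (flags n (suc a) (suc b))
                             ++ List.map (extend false true) (flags n (suc a) b)
                             ++ List.map (extend true true) (flags n a b)

flags-correct : ∀ n a b → All (IsFlag a b) (flags n a b)
flags-correct zero    a       (suc b) = []
flags-correct zero    zero    zero    = ((λ ()) , refl , refl) ∷ []
flags-correct zero    (suc a) zero    = []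
flags-correct (suc n) a       zero    =
  map⁺ (All.map IsFlag-outer (flags-correct n a zero))
flags-correct (suc n) zero    (suc b) = ++⁺
  (map⁺ (All.map IsFlag-outer (flags-correct n zero (suc b))))
  (map⁺ (All.map IsFlag-shell (flags-correct n zero b)))
flags-correct (suc n) (suc a) (suc b) = ++⁺
  (map⁺ (All.map IsFlag-outer (flags-correct n (suc a) (suc b)))) (++⁺
  (map⁺ (All.map IsFlag-shell (flags-correct n (suc a) b)))
  (map⁺ (All.map IsFlag-core (flags-correct n a b))))

extend-disjoint : ∀ {n s t s′ t′} {us vs : List (Pair n)} → (s , t) ≢ (s′ , t′) →
                  Disjoint (List.map (extend s t) us) (List.map (extend s′ t′) vs)
extend-disjoint ne (p , q) with ∈-map⁻ _ p | ∈-map⁻ _ q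
... | _ , _ , refl | _ , _ , refl = ne refl

flags-unique : ∀ n a b → Unique (flags n a b)
flags-unique zero    a       (suc b) = []
flags-unique zero    zero    zero    = [] ∷ []
flags-unique zero    (suc a) zero    = []
flags-unique (suc n) a       zero    = Unique.map⁺ extend-injective (flags-unique n a zero)
flags-unique (suc n) zero    (suc b) = Unique.++⁺
  (Unique.map⁺ extend-injective (flags-unique n zero (suc b)))
  (Unique.map⁺ extend-injective (flags-unique n zero b))
  (extend-disjoint {us = flags n zero (suc b)} λ ())
flags-unique (suc n) (suc a) (suc b) = Unique.++⁺
  (Unique.map⁺ extend-injective (flags-unique n (suc a) (suc b)))
  (Unique.++⁺ (Unique.map⁺ extend-injective (flags-unique n (suc a) b))
              (Unique.map⁺ extend-injective (flags-unique n a b))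
              (extend-disjoint {us = flags n (suc a) b} λ ()))
  (λ (p , q) → [ (λ q′ → extend-disjoint {us = flags n (suc a) (suc b)} (λ ()) (p , q′))
               , (λ q′ → extend-disjoint {us = flags n (suc a) (suc b)} (λ ()) (p , q′)) ]′
               (∈-++⁻ (List.map (extend false true) (flags n (suc a) b)) q))

-- Pascal's rule is applied twice: shell and core together give the binomial coefficient for A
-- inside B, and adding outer gives the one for B inside [n].
length-flags : ∀ n a b → length (flags n a b) ≡ (n C b) * (b C a)
length-flags zero    a       (suc b) = refl
length-flags zero    zero    zero    = refl
length-flags zero    (suc a) zero    = refl
length-flags (suc n) a       zero    = trans (length-map _ (flags n a zero)) (length-flags n a zero)
length-flags (suc n) zero    (suc b) = begin
  length (flags (suc n) zero (suc b))
    ≡⟨ trans (length-++ (List.map (extend false false) (flags n zero (suc b))))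
             (cong₂ _+_ (trans (length-map _ (flags n zero (suc b))) (length-flags n zero (suc b)))
                        (trans (length-map _ (flags n zero b)) (length-flags n zero b))) ⟩
  (n C suc b) * 1 + (n C b) * 1
    ≡⟨ gather (n C b) (n C suc b) ⟩
  ((n C b) + (n C suc b)) * 1
    ≡⟨ cong (_* 1) (nCk+nC[k+1]≡[n+1]C[k+1] n b) ⟩
  (suc n C suc b) * 1 ∎
  where
  open ≡-Reasoning
  gather : ∀ x y → y * 1 + x * 1 ≡ (x + y) * 1
  gather = solve-∀
length-flags (suc n) (suc a) (suc b) = begin
  length (flags (suc n) (suc a) (suc b))
    ≡⟨ trans (length-++ (List.map (extend false false) (flags n (suc a) (suc b))))
       (cong₂ _+_ (trans (length-map _ (flags n (suc a) (suc b))) (length-flags n (suc a) (suc b)))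
         (trans (length-++ (List.map (extend false true) (flags n (suc a) b)))
         (cong₂ _+_ (trans (length-map _ (flags n (suc a) b)) (length-flags n (suc a) b))
                    (trans (length-map _ (flags n a b)) (length-flags n a b))))) ⟩
  (n C suc b) * (suc b C suc a) + ((n C b) * (b C suc a) + (n C b) * (b C a))
    ≡⟨ gather (n C suc b) (suc b C suc a) (n C b) (b C suc a) (b C a) ⟩
  (n C suc b) * (suc b C suc a) + (n C b) * ((b C a) + (b C suc a))
    ≡⟨ cong (λ k → (n C suc b) * (suc b C suc a) + (n C b) * k) (nCk+nC[k+1]≡[n+1]C[k+1] b a) ⟩
  (n C suc b) * (suc b C suc a) + (n C b) * (suc b C suc a)
    ≡⟨ gather′ (n C suc b) (n C b) (suc b C suc a) ⟩
  ((n C b) + (n C suc b)) * (suc b C suc a)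
    ≡⟨ cong (_* (suc b C suc a)) (nCk+nC[k+1]≡[n+1]C[k+1] n b) ⟩
  (suc n C suc b) * (suc b C suc a) ∎
  where
  open ≡-Reasoning
  gather : ∀ x y z p q → x * y + (z * p + z * q) ≡ x * y + z * (q + p)
  gather = solve-∀
  gather′ : ∀ x z y → x * y + z * y ≡ (z + x) * y
  gather′ = solve-∀

star : ∀ n → ℕ → ℕ → List (Pair (suc n))
star n a b = List.map (extend false false) (flags n a b)

-- Adjacency would force B ∪ B′ to be everything, but the first point lies in neither set.
star-independent : ∀ n a b → suc n < 2 * b → IsIndependent a b (star n a b)
star-independent n a b n<2b =
    star-flags
  , Unique.map⁺ extend-injective (flags-unique n a b)
  , AllPairs.map⁺ (pairwise (flags-correct n a b))
  where
  star-flags : All (IsFlag a b) (star n a b)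
  star-flags = map⁺ (All.map IsFlag-outer (flags-correct n a b))
  nonadjacent : ∀ {u v : Pair n} → IsFlag a b u → IsFlag a b v → ¬ Adj (extend false false u) (extend false false v)
  nonadjacent fu fv adj with () ← flags-cover n<2b (IsFlag-outer fu) (IsFlag-outer fv) adj
  pairwise : ∀ {S} → All (IsFlag a b) S → AllPairs (λ u v → ¬ Adj (extend false false u) (extend false false v)) S
  pairwise []       = []
  pairwise (f ∷ fs) = All.map (nonadjacent f) fs ∷ pairwise fs

-- Choice of the shell lengths.

mainTheorem9 : (a b n : ℕ) → 1 ≤ a → 1 ≤ b → 1 ≤ n → n < 2 * b → a + 3 * b ≤ 2 * n →
    IndependenceNumberIs n a b (((n ∸ 1) C b) * (b C a))
mainTheorem9 a b (suc n) 1≤a 1≤b 1≤n n<2b a+3b≤2n =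
    (star n a b , star-independent n a b n<2b , trans (length-map _ (flags n a b)) (length-flags n a b))
  , bound
  where
  open ≤-Reasoning
  a<b : a < b
  a<b = +-cancelʳ-< (3 * b) a b (begin-strict
    a + 3 * b   ≤⟨ a+3b≤2n ⟩
    2 * suc n   <⟨ *-monoʳ-< 2 n<2b ⟩
    2 * (2 * b) ≡⟨ four b ⟩
    b + 3 * b   ∎)
    where
    four : ∀ b → 2 * (2 * b) ≡ b + 3 * b
    four = solve-∀
  b<n : b < suc n
  b<n = *-cancelˡ-< 2 b (suc n) (begin-strict
    2 * b       <⟨ m<n+m (2 * b) 1≤b ⟩
    b + 2 * b   ≤⟨ m≤n+m (3 * b) a ⟩
    a + 3 * b   ≤⟨ a+3b≤2n ⟩
    2 * suc n   ∎)
  ∃[c]c+b≡n : ∃ λ c → c + b ≡ n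
  ∃[c]c+b≡n = n ∸ b , m∸n+n≡m (≤-pred b<n)
  bound : ∀ (S : List (Pair (suc n))) → IsIndependent a b S → length S ≤ (n C b) * (b C a)
  -- The b - a = `e` shell letters are split as evenly as possible around the core, with the larger
  -- half behind it.
  bound with e , refl ← m≤n⇒∃[o]m+o≡n (<⇒≤ a<b) | c , refl ← ∃[c]c+b≡n =
    bound′ (split ⌊ e /2⌋ a ⌈ e /2⌉ (⌊n/2⌋+⌈n/2⌉≡n e)) n<2b
    where
    split : ∀ d₁ a d₂ {e} → d₁ + d₂ ≡ e → d₁ + (a + d₂) ≡ a + e
    split d₁ a d₂ refl = shuffle d₁ a d₂
      where
      shuffle : ∀ d a e → d + (a + e) ≡ a + (d + e)
      shuffle = solve-∀
    2a+e≤2c : (a + a) + e ≤ suc c + suc c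
    -- Adding 2b to both sides turns the claim into a + 3b ≤ 2n.
    2a+e≤2c = +-cancelʳ-≤ (2 * (a + e)) _ _ (begin
      (a + a) + e + 2 * (a + e)         ≡⟨ lhs a e ⟩
      a + 3 * (a + e)                   ≤⟨ a+3b≤2n ⟩
      2 * suc (c + (a + e))             ≡⟨ rhs (suc c) (a + e) ⟩
      suc c + suc c + 2 * (a + e)       ∎)
      where
      lhs : ∀ a e → (a + a) + e + 2 * (a + e) ≡ a + 3 * (a + e)
      lhs = solve-∀
      rhs : ∀ c b → 2 * (c + b) ≡ c + c + 2 * b
      rhs = solve-∀
    a+⌈e/2⌉≤c : a + ⌈ e /2⌉ ≤ suc c
    a+⌈e/2⌉≤c = begin
      a + ⌈ e /2⌉           ≡⟨ ⌈m+m+n/2⌉ a e ⟨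
      -- Halving with rounding up loses nothing on the right, since `suc c + suc c` is even.
      ⌈ a + a + e /2⌉       ≤⟨ ⌈n/2⌉-mono 2a+e≤2c ⟩
      ⌈ suc c + suc c /2⌉   ≡⟨ n≡⌈n+n/2⌉ (suc c) ⟨
      suc c                 ∎
      where
      ⌈m+m+n/2⌉ : ∀ m n → ⌈ m + m + n /2⌉ ≡ m + ⌈ n /2⌉
      ⌈m+m+n/2⌉ zero    n = refl
      ⌈m+m+n/2⌉ (suc m) n =
        trans (cong (λ k → ⌈ suc (k + n) /2⌉) (+-suc m m)) (cong suc (⌈m+m+n/2⌉ m n))
    ⌊e/2⌋+a≤c : ⌊ e /2⌋ + a ≤ suc c
    ⌊e/2⌋+a≤c = begin
      ⌊ e /2⌋ + a           ≡⟨ +-comm ⌊ e /2⌋ a ⟩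
      a + ⌊ e /2⌋           ≤⟨ +-monoʳ-≤ a (⌊n/2⌋≤⌈n/2⌉ e) ⟩
      a + ⌈ e /2⌉           ≤⟨ a+⌈e/2⌉≤c ⟩
      suc c                 ∎
    -- A variable in place of `a + e` lets the equation for the split be matched with `refl`.
    bound′ : ∀ {b} → ⌊ e /2⌋ + (a + ⌈ e /2⌉) ≡ b → suc c + b < 2 * b →
             ∀ (S : List (Pair (suc c + b))) → IsIndependent a b S → length S ≤ ((c + b) C b) * (b C a)
    bound′ refl = length-bound c ⌊ e /2⌋ a ⌈ e /2⌉ ⌊e/2⌋+a≤c a+⌈e/2⌉≤c
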